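{- For every integer $n\ge 3$, there exists a ucycle of $\mathcal P(n,2)$.
   Context: $[m]=\{1,\dots,m\}$; $\mathcal P(n,2)$ is the set of partitions of $[n]$ into exactly $2$ nonempty parts, and $S(n,2)=|\mathcal P(n,2)|$. A string $r_1\cdots r_n$ over the alphabet $\{1,2\}$ represents $p\in\mathcal P(n,2)$ if $r_i=r_j$ iff $i,j$ lie in the same part of $p$. A ucycle of $\mathcal P(n,2)$ is a cyclic string $a_1\cdots a_N$ over $\{1,2\}$, $N=S(n,2)$, indices modulo $N$, such that each element of $\mathcal P(n,2)$ is represented by exactly one of the windows $a_i a_{i+1}\cdots a_{i+n-1}$, $1\le i\le N$. -}

module Defs where

open import Data.Nat.Base using (ℕ; _+_)
open import Data.Nat.DivMod using (_mod_)
open import Data.Fin.Base using (Fin; toℕ)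
open import Data.Fin.Properties using (nonZeroIndex)
open import Data.Fin.Subset using (Subset; Nonempty; _∈_)
open import Data.Product using (∃; ∃-syntax; ∃!; _×_)
open import Data.Vec.Functional using (Vector)
open import Function.Bundles using (_⇔_; Inverse)
open import Function.Properties.Equivalence using (⇔-isEquivalence)
open import Level using (0ℓ)
open import Relation.Binary.Bundles using (Setoid)
open import Relation.Binary.Structures using (IsEquivalence)
open import Relation.Binary.PropositionalEquality using (_≡_; setoid)

private
  variable
    n k N : ℕ

-- The numbering of the parts is an artefact of the encoding: it is forgotten
-- by _≈ₚ_ below. The parts are pairwise distinct, because they are nonempty
-- and disjoint, so there are exactly k of them.
record Partition (n k : ℕ) : Set where
  field
    part     : Fin k → Subset n
    nonempty : ∀ b → Nonempty (part b)
    disjoint : ∀ {b c x} → x ∈ part b → x ∈ part c → b ≡ c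
    covers   : ∀ x → ∃[ b ] x ∈ part b

open Partition public

IsPartOf : Subset n → Partition n k → Set
IsPartOf s p = ∃[ b ] part p b ≡ s

SamePart : Partition n k → Fin n → Fin n → Set
SamePart p x y = ∃[ s ] IsPartOf s p × x ∈ s × y ∈ s

infix 4 _≈ₚ_

_≈ₚ_ : Partition n k → Partition n k → Set
p ≈ₚ q = ∀ s → IsPartOf s p ⇔ IsPartOf s q

≈ₚ-isEquivalence : IsEquivalence (_≈ₚ_ {n} {k})
≈ₚ-isEquivalence = record
  { refl  = λ s → E.refl
  ; sym   = λ p≈q s → E.sym (p≈q s)
  ; trans = λ p≈q q≈r s → E.trans (p≈q s) (q≈r s)
  }
  where module E = IsEquivalence (⇔-isEquivalence {0ℓ})

𝒫 : ℕ → ℕ → Setoid 0ℓ 0ℓ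
𝒫 n k = record
  { Carrier       = Partition n k
  ; _≈_           = _≈ₚ_
  ; isEquivalence = ≈ₚ-isEquivalence
  }

HasCardinality : Setoid 0ℓ 0ℓ → ℕ → Set
HasCardinality S N = Inverse (setoid (Fin N)) S

-- The alphabet {1,2} is Fin 2, and all indices start at 0.
Letter : Set
Letter = Fin 2

Represents : Vector Letter n → Partition n 2 → Set
Represents r p = ∀ i j → r i ≡ r j ⇔ SamePart p i j

window : ∀ n → Vector Letter N → Fin N → Vector Letter n
window {N} n a i j = a ((toℕ i + toℕ j) mod N)
  where instance _ = nonZeroIndex i

record IsUcycle (n : ℕ) {N : ℕ} (a : Vector Letter N) : Set where
  field
    length     : HasCardinality (𝒫 n 2) N
    represents : ∀ p → ∃! _≡_ λ i → Represents (window n a i) p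

{-# OPTIONS --safe #-}

-- Up to exchanging the two letters, a string of length n is determined by the
-- n − 1 differences of consecutive letters, and it represents a partition into two
-- nonempty parts iff these are not all zero. So a ucycle is a cyclic string whose
-- cyclic difference string d is a de Bruijn cycle on the nonzero words of length
-- m = n − 1. Conversely d can be integrated around the cycle iff its letters sum to
-- zero mod 2, which holds for m ≥ 2 because 2^(m−1) nonzero words begin with 1.
--
-- The cycle d is built by joining orbits of cyclic rotation: starting with 1…1, any
-- nonzero word with a 0 is a rotation of some u0, and the orbit of u0 is joined to
-- the cycle through u1 because u0 and u1 have the same predecessors.
module Submission where

open import Defs
open import Algebra.Bundles using (CommutativeRing)
open import Data.Bool.Base using (Bool; true; false; not; _xor_)
open import Data.Bool.Properties
  using (not-injective; not-involutive; xor-assoc; xor-same; xor-identityʳ; xor-∧-commutativeRing)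
  renaming (_≟_ to _≟ᵇ_)
open import Data.Fin.Base using (Fin; zero; suc; toℕ; inject₁)
open import Data.Fin.Properties using (2↔Bool; toℕ-fromℕ<; toℕ-inject₁) renaming (_≟_ to _≟ᶠ_)
open import Data.Fin.Subset using (Subset; _⊆_) renaming (_∈_ to _∈ₛ_)
open import Data.Fin.Subset.Properties using (⊆-antisym)
open import Data.List.Base
  using (List; []; _∷_; [_]; _++_; _∷ʳ_; length; map; foldr; filter; replicate; take; tabulate; lookup; applyUpTo)
open import Data.List.Membership.Propositional using (_∈_)
open import Data.List.Membership.Propositional.Properties
  using (∈-++⁺ˡ; ∈-++⁺ʳ; ∈-++⁻; ∈-∃++; ∈-map⁺; ∈-map⁻; ∈-lookup; ∈-applyUpTo⁺; ∈-applyUpTo⁻)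
open import Data.List.Membership.Propositional.Properties.WithK using (unique∧set⇒bag)
open import Data.List.Properties
  using (≡-dec; ∷-injectiveˡ; ∷-injectiveʳ; ∷ʳ-injective; ++-assoc; ++-identityʳ; map-++; tabulate-cong;
         take-all; length-++; length-replicate; length-tabulate)
open import Data.List.Membership.DecPropositional (≡-dec _≟ᵇ_) using (_∈?_)
open import Data.List.Relation.Binary.BagAndSetEquality using (∼bag⇒↭)
open import Data.List.Relation.Binary.Disjoint.Propositional using (Disjoint)
open import Data.List.Relation.Binary.Permutation.Propositional
  using (_↭_; prep; ↭-refl; ↭-sym; ↭-trans; ↭-reflexive; ↭⇒↭ₛ)
open import Data.List.Relation.Binary.Permutation.Propositional.Properties
  using (∈-resp-↭; ↭-length; ++-comm; ∷↭∷ʳ; filter-↭)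
  renaming (shift to ↭-shift; map⁺ to ↭-map⁺)
open import Data.List.Relation.Binary.Permutation.Setoid.Properties using (Unique-resp-↭; foldr-commMonoid)
import Data.List.Relation.Unary.All as All
open import Data.List.Relation.Unary.AllPairs using ([]; _∷_)
open import Data.List.Relation.Unary.Any using (here; there; index)
open import Data.List.Relation.Unary.Any.Properties using (lookup-index)
open import Data.List.Relation.Unary.Unique.Propositional using (Unique)
open import Data.List.Relation.Unary.Unique.Propositional.Properties
  using (++⁺; applyUpTo⁺₁) renaming (map⁺ to Unique-map⁺)
open import Data.Nat.Base using (ℕ; zero; suc; _+_; _*_; _∸_; _≤_; _<_; z≤n; s≤s; NonZero)
open import Data.Nat.DivMod using (_mod_; _%_; _/_; m%n<n; m≡m%n+[m/n]*n)
open import Data.Nat.GeneralisedArithmetic using (fold)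
open import Data.Nat.Properties
  using (_≟_; suc-injective; ≤-reflexive; ≤-trans; ≤∧≢⇒<; <⇒≤; m≤n⇒m≤n+o; +-suc; +-comm; +-assoc;
         +-identityʳ; m+[n∸m]≡n; m∸n+n≡m; m∸n≤m; m<n⇒0<n∸m)
open import Data.Product using (Σ-syntax; ∃; ∃₂; ∃-syntax; ∃!; _×_; _,_; proj₁; proj₂)
open import Data.Sum using (_⊎_; inj₁; inj₂; [_,_]′)
import Data.Vec.Base as Vec
open import Data.Vec.Functional using (Vector)
open import Data.Vec.Properties using ([]=⇒lookup; lookup⇒[]=; lookup∘tabulate)
open import Function.Base using (_∘_; id)
open import Function.Bundles using (_⇔_; mk⇔; Equivalence; Injection; Inverse)
open import Function.Construct.Composition using (_⇔-∘_)
open import Function.Construct.Identity using (⇔-id)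
open import Function.Construct.Symmetry using (⇔-sym)
open import Function.Properties.Inverse using (↔⇒↣)
open import Relation.Binary.PropositionalEquality hiding ([_])
open import Relation.Nullary using (¬_; yes; no; does; contradiction)
open import Relation.Nullary.Decidable using (dec-true)
open import Relation.Unary using (Pred; Decidable)

open Equivalence using (to; from)

-- Tours of rotation-closed sets of words

Word : Set
Word = List Bool

infix 4 _⟶_

-- The edges of the de Bruijn graph: two words overlap in all but one letter at either end.
data _⟶_ : Word → Word → Set where
  shift : ∀ b u c → b ∷ u ⟶ u ∷ʳ c

-- Walk x ws y lists the vertices of a walk from x to y, excluding y.
data Walk : Word → List Word → Word → Set where
  []  : ∀ {x} → Walk x [] x
  _∷_ : ∀ {x y ws z} → x ⟶ y → Walk y ws z → Walk x (x ∷ ws) z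

Walk-++ : ∀ {x y z vs ws} → Walk x vs y → Walk y ws z → Walk x (vs ++ ws) z
Walk-++ []      q = q
Walk-++ (e ∷ p) q = e ∷ Walk-++ p q

Walk-split : ∀ {x z} vs {y ws} → Walk x (vs ++ y ∷ ws) z → Walk x vs y × Walk y (y ∷ ws) z
Walk-split []       (e ∷ p) = [] , e ∷ p
Walk-split (v ∷ vs) (e ∷ p) = let q , r = Walk-split vs p in e ∷ q , r

⟶-retarget : ∀ {x} u {c c′} → x ⟶ u ∷ʳ c → x ⟶ u ∷ʳ c′
⟶-retarget u e = go e refl
  where
  -- The target is a variable with an equation, since an index `u ∷ʳ c` cannot be unified with that
  -- of `shift`.
  go : ∀ {x y c c′} → x ⟶ y → y ≡ u ∷ʳ c → x ⟶ u ∷ʳ c′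
  go (shift b v _) eq with refl , _ ← ∷ʳ-injective v u eq = shift b v _

-- Only the last edge changes, and its target is not listed, so the list stays the same. It is
-- nonempty so that there is an edge to redirect.
Walk-retarget : ∀ {x y z v vs} u {c c′} → y ≡ u ∷ʳ c → z ≡ u ∷ʳ c′ →
                Walk x (v ∷ vs) y → Walk x (v ∷ vs) z
Walk-retarget u refl refl (e ∷ [])        = ⟶-retarget u e ∷ []
Walk-retarget u y≡   z≡   (e ∷ p@(_ ∷ _)) = e ∷ Walk-retarget u y≡ z≡ p

Walk-applyUpTo : ∀ (s : ℕ → Word) → (∀ i → s i ⟶ s (suc i)) → ∀ n → Walk (s 0) (applyUpTo s n) (s n)
Walk-applyUpTo s e zero    = []
Walk-applyUpTo s e (suc n) = e 0 ∷ Walk-applyUpTo (s ∘ suc) (e ∘ suc) n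

rotate : Word → Word
rotate []      = []
rotate (b ∷ w) = w ∷ʳ b

rotate-injective : ∀ {v w} → rotate v ≡ rotate w → v ≡ w
rotate-injective {[]}    {[]}    eq = refl
rotate-injective {[]}    {_ ∷ []} ()
rotate-injective {[]}    {_ ∷ _ ∷ _} ()
rotate-injective {_ ∷ []} {[]} ()
rotate-injective {_ ∷ _ ∷ _} {[]} ()
rotate-injective {b ∷ v} {c ∷ w} eq with refl , refl ← ∷ʳ-injective v w eq = refl

rotate-↭ : ∀ w → rotate w ↭ w
rotate-↭ []      = ↭-refl
rotate-↭ (b ∷ w) = ↭-sym (∷↭∷ʳ b w)

rotations : Word → ℕ → Word
rotations w = fold w rotate

rotations-↭ : ∀ w i → rotations w i ↭ w
rotations-↭ w zero    = ↭-refl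
rotations-↭ w (suc i) = ↭-trans (rotate-↭ (rotations w i)) (rotations-↭ w i)

rotations-rotate : ∀ w i → rotations (rotate w) i ≡ rotations w (suc i)
rotations-rotate w zero    = refl
rotations-rotate w (suc i) = cong rotate (rotations-rotate w i)

rotations-+ : ∀ w i j → rotations (rotations w j) i ≡ rotations w (i + j)
rotations-+ w zero    j = refl
rotations-+ w (suc i) j = cong rotate (rotations-+ w i j)

rotations-++ : ∀ u v → rotations (u ++ v) (length u) ≡ v ++ u
rotations-++ []      v = sym (++-identityʳ v)
rotations-++ (b ∷ u) v = begin
  rotations (b ∷ u ++ v) (suc (length u))      ≡⟨ rotations-rotate (b ∷ u ++ v) (length u) ⟨
  rotations ((u ++ v) ∷ʳ b) (length u)         ≡⟨ cong (λ w → rotations w (length u)) (++-assoc u v [ b ]) ⟩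
  rotations (u ++ v ∷ʳ b) (length u)           ≡⟨ rotations-++ u (v ∷ʳ b) ⟩
  v ∷ʳ b ++ u                                  ≡⟨ ++-assoc v [ b ] u ⟩
  v ++ b ∷ u                                   ∎
  where open ≡-Reasoning

rotations-length : ∀ w → rotations w (length w) ≡ w
rotations-length w =
  trans (cong (λ v → rotations v (length w)) (sym (++-identityʳ w))) (rotations-++ w [])

-- Rotation is injective, so a repetition in the orbit can be pulled back to its first word.
rotations-cancel : ∀ w i {j} → rotations w i ≡ rotations w (i + j) → w ≡ rotations w j
rotations-cancel w zero    eq = eq
rotations-cancel w (suc i) eq = rotations-cancel w i (rotate-injective eq)

least : ∀ {p} {P : Pred ℕ p} → Decidable P → ∀ n → P n → ∃ λ k → P k × (∀ {j} → j < k → ¬ P j)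
least P? zero    p = zero , p , λ ()
least P? (suc n) p with P? zero
... | yes p₀ = zero , p₀ , λ ()
... | no ¬p₀ =
  let k , pk , min = least (P? ∘ suc) n p
  in suc k , pk , λ { {zero} _ → ¬p₀ ; {suc j} (s≤s j<k) → min j<k }

-- A cycle in the de Bruijn graph on nonzero words. By `closed` its vertex set is a union of
-- rotation orbits, so a further orbit lies inside it or is disjoint from it.
record Tour (m : ℕ) : Set where
  field
    start  : Word
    rest   : List Word

  words : List Word
  words = start ∷ rest

  field
    walk   : Walk start words start
    unique : Unique words
    closed : ∀ {w} → w ∈ words → rotate w ∈ words
    valid  : ∀ {w} → w ∈ words → length w ≡ m × true ∈ w

  closed* : ∀ {w} i → w ∈ words → rotations w i ∈ words
  closed* zero    w∈ = w∈
  closed* (suc i) w∈ = closed (closed* i w∈)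

open Tour

rotate-⟶ : ∀ {w} → true ∈ w → w ⟶ rotate w
rotate-⟶ {b ∷ w} _ = shift b w b

-- Rotation is the edge that appends the letter just dropped, so an orbit is a closed walk. The last
-- component, a way back to `w`, serves to prove disjointness from other tours.
orbit : ∀ {m} w → length w ≡ suc m → true ∈ w →
        ∃[ T ] start {suc m} T ≡ w × w ∈ words T × (∀ {v} → v ∈ words T → ∃[ i ] rotations v i ≡ w)
orbit {m} w len t = record
  { start  = w
  ; rest   = applyUpTo (r ∘ suc) k
  ; walk   = subst (Walk w ws) r-suc-k
               (Walk-applyUpTo r (λ i → rotate-⟶ (∈-resp-↭ (↭-sym (rotations-↭ w i)) t)) (suc k))
  ; unique = applyUpTo⁺₁ r (suc k) distinct
  ; closed = closed-ws
  ; valid  = valid-ws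
  } , refl , here refl , back
  where
  r : ℕ → Word
  r = rotations w

  -- The length `suc m` is a period, so the search succeeds by `m`. The least period is written
  -- `suc k` to keep it positive.
  leastPeriod : ∃[ k ] r (suc k) ≡ w × (∀ {j} → j < k → r (suc j) ≢ w)
  leastPeriod = least (λ i → ≡-dec _≟ᵇ_ (r (suc i)) w) m (trans (cong r (sym len)) (rotations-length w))

  k : ℕ
  k = proj₁ leastPeriod

  r-suc-k : r (suc k) ≡ w
  r-suc-k = proj₁ (proj₂ leastPeriod)

  ws : List Word
  ws = applyUpTo r (suc k)

  -- A repetition at distance `suc l` would make `suc l` a period smaller than `suc k`.
  distinct : ∀ {i j} → i < j → j < suc k → r i ≢ r j
  distinct {i} {j} i<j (s≤s j≤k) eq with j ∸ i in d | m<n⇒0<n∸m i<j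
  ... | suc l | _ = proj₂ (proj₂ leastPeriod) (subst (_≤ k) d (≤-trans (m∸n≤m j i) j≤k))
    (sym (rotations-cancel w i (trans eq (cong r (trans (sym (m+[n∸m]≡n (<⇒≤ i<j))) (cong (i +_) d))))))

  closed-ws : ∀ {v} → v ∈ ws → rotate v ∈ ws
  closed-ws v∈ with i , s≤s i≤k , refl ← ∈-applyUpTo⁻ r v∈ with i ≟ k
  ... | yes refl = here r-suc-k
  ... | no  i≢k  = ∈-applyUpTo⁺ r (s≤s (≤∧≢⇒< i≤k i≢k))

  valid-ws : ∀ {v} → v ∈ ws → length v ≡ suc m × true ∈ v
  valid-ws v∈ with i , _ , refl ← ∈-applyUpTo⁻ r v∈ =
    trans (↭-length (rotations-↭ w i)) len , ∈-resp-↭ (↭-sym (rotations-↭ w i)) t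

  back : ∀ {v} → v ∈ ws → ∃[ i ] rotations v i ≡ w
  back v∈ with i , i<k , refl ← ∈-applyUpTo⁻ r v∈ =
    suc k ∸ i , trans (rotations-+ w (suc k ∸ i) i) (trans (cong r (m∸n+n≡m (<⇒≤ i<k))) r-suc-k)

-- A closed walk may begin at any of its vertices: cut the list at `y` and exchange the two pieces.
-- This brings a tour into the form that `join` takes.
startAt : ∀ {m y} (T : Tour m) → y ∈ words T → ∃[ T′ ] start {m} T′ ≡ y × words T′ ↭ words T
startAt {y = y} T y∈ = record
  { start  = y
  ; rest   = ws ++ vs
  ; walk   = let p , q = Walk-split vs (subst (λ us → Walk (start T) us (start T)) eq (walk T))
             in Walk-++ q p
  ; unique = Unique-resp-↭ (setoid Word) (↭⇒↭ₛ (↭-sym perm)) (unique T)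
  ; closed = λ v∈ → ∈-resp-↭ (↭-sym perm) (closed T (∈-resp-↭ perm v∈))
  ; valid  = λ v∈ → valid T (∈-resp-↭ perm v∈)
  } , refl , perm
  where
  vs ws : List Word
  vs = proj₁ (∈-∃++ y∈)
  ws = proj₁ (proj₂ (∈-∃++ y∈))

  eq : words T ≡ vs ++ y ∷ ws
  eq = proj₂ (proj₂ (∈-∃++ y∈))

  perm : y ∷ ws ++ vs ↭ words T
  perm = ↭-trans (++-comm (y ∷ ws) vs) (↭-reflexive (sym eq))

infix 4 _⊑_

_⊑_ : ∀ {m} → Tour m → Tour m → Set
S ⊑ T = ∀ {w} → w ∈ words S → w ∈ words T

-- Every edge into u ∷ʳ c can be redirected to u ∷ʳ c′: exchanging the two
-- successors merges two disjoint closed walks through these words into one.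
join : ∀ {m} (S T : Tour m) u {c c′} → start S ≡ u ∷ʳ c → start T ≡ u ∷ʳ c′ →
       Disjoint (words S) (words T) → ∃[ R ] S ⊑ R × T ⊑ R
join S T u eqS eqT disj = record
  { start  = start S
  ; rest   = rest S ++ words T
  ; walk   = Walk-++ (Walk-retarget u eqS eqT (walk S)) (Walk-retarget u eqT eqS (walk T))
  ; unique = ++⁺ (unique S) (unique T) disj
  ; closed = λ w∈ → [ ∈-++⁺ˡ ∘ closed S , ∈-++⁺ʳ (words S) ∘ closed T ]′ (∈-++⁻ (words S) w∈)
  ; valid  = λ w∈ → [ valid S , valid T ]′ (∈-++⁻ (words S) w∈)
  } , ∈-++⁺ˡ , ∈-++⁺ʳ (words S)

falses : Word → ℕ
falses w = length (filter (_≟ᵇ false) w)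

falses-↭ : ∀ {v w} → v ↭ w → falses v ≡ falses w
falses-↭ p = ↭-length (filter-↭ (_≟ᵇ false) p)

falses≡0 : ∀ w → falses w ≡ 0 → w ≡ replicate (length w) true
falses≡0 []         _  = refl
falses≡0 (true ∷ w) eq = cong (true ∷_) (falses≡0 w eq)

falses≡suc : ∀ w {k} → falses w ≡ suc k → ∃₂ λ u v → w ≡ u ++ false ∷ v
falses≡suc (false ∷ w) _  = [] , w , refl
falses≡suc (true ∷ w)  eq = let u , v , w≡ = falses≡suc w eq in true ∷ u , v , cong (true ∷_) w≡

-- A word containing false has a rotation u ∷ʳ false, and the orbit of u ∷ʳ false
-- can be joined to any tour through u ∷ʳ true.
add : ∀ {m} k w → length w ≡ suc m → true ∈ w → falses w ≡ k →
      (T : Tour (suc m)) → replicate (suc m) true ∈ words T → ∃[ T′ ] T ⊑ T′ × w ∈ words T′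
add zero w len t f T full∈ = T , id ,
  subst (_∈ words T) (sym (trans (falses≡0 w f) (cong (λ l → replicate l true) len))) full∈
add {m} (suc k) w len t f T full∈ with u , v , refl ← falses≡suc w f = result
  where
  y z z⁺ : Word
  -- Reading `w` cyclically from just after the chosen `false` moves that letter to the end.
  y  = v ++ u
  z  = y ∷ʳ false
  z⁺ = y ∷ʳ true

  z↭w : z ↭ w
  z↭w = ↭-sym (↭-trans (↭-shift false u v) (↭-trans (prep false (++-comm u v)) (∷↭∷ʳ false y)))

  length-z : length z ≡ suc m
  length-z = trans (↭-length z↭w) len

  length-z⁺ : length z⁺ ≡ suc m
  length-z⁺ = trans (length-++ y) (trans (sym (length-++ y)) length-z)

  falses-z⁺ : falses z⁺ ≡ k
  falses-z⁺ = suc-injective (trans (cong suc (falses-↭ (↭-sym (∷↭∷ʳ true y))))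
                                   (trans (falses-↭ (↭-trans (∷↭∷ʳ false y) z↭w)) f))

  rotate-z : rotations z (length v) ≡ w
  rotate-z = trans (cong (λ x → rotations x (length v)) (++-assoc v u [ false ]))
                   (trans (rotations-++ v (u ∷ʳ false)) (++-assoc u [ false ] v))

  result : ∃[ T′ ] T ⊑ T′ × w ∈ words T′
  -- `z⁺` has one `false` fewer than `w`, so the recursion on the number of `false` letters reaches
  -- it.
  result with add k z⁺ length-z⁺ (∈-++⁺ʳ y (here refl)) falses-z⁺ T full∈
  ... | T₁ , T⊑T₁ , z⁺∈ with z ∈? words T₁
  ... | yes z∈ = T₁ , T⊑T₁ , subst (_∈ words T₁) rotate-z (closed* T₁ (length v) z∈)
  ... | no  z∉ =
    let T₂ , start-T₂ , T₂↭T₁     = startAt T₁ z⁺∈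
        O , start-O , z∈O , back = orbit z length-z (∈-resp-↭ (↭-sym z↭w) t)
        -- A common word could be rotated to `z`, which would then lie in the rotation-closed `T₁`.
        disj : Disjoint (words T₂) (words O)
        disj = λ (x∈T₂ , x∈O) →
          let i , eq = back x∈O in z∉ (subst (_∈ words T₁) eq (closed* T₁ i (∈-resp-↭ T₂↭T₁ x∈T₂)))
        R , T₂⊑R , O⊑R           = join T₂ O y start-T₂ start-O disj
    in R , (λ x∈ → T₂⊑R (∈-resp-↭ (↭-sym T₂↭T₁) (T⊑T₁ x∈)))
         , subst (_∈ words R) rotate-z (closed* R (length v) (O⊑R z∈O))

-- Words are added one by one to the orbit of 1...1; that word is kept in the tour because the
-- recursion of `add` ends there.
cover : ∀ {m} ws → (∀ {w} → w ∈ ws → length w ≡ suc m × true ∈ w) →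
        ∃[ T ] (∀ {w} → w ∈ ws → w ∈ words {suc m} T) × replicate (suc m) true ∈ words T
cover {m} [] _ =
  let T , _ , full∈ , _ = orbit (replicate (suc m) true) (length-replicate (suc m)) (here refl)
  in T , (λ ()) , full∈
cover (w ∷ ws) valid-ws =
  let T , ws∈ , full∈ = cover ws (valid-ws ∘ there)
      len , t          = valid-ws (here refl)
      T′ , T⊑T′ , w∈ = add (falses w) w len t refl T full∈
  in T′ , (λ { (here refl) → w∈ ; (there x∈) → T⊑T′ (ws∈ x∈) }) , T⊑T′ full∈

-- Parity of the leading letters

allWords : ℕ → List Word
allWords zero    = [ [] ]
allWords (suc m) = map (true ∷_) (allWords m) ++ map (false ∷_) (allWords m)

nonzeroWords : ℕ → List Word
nonzeroWords zero    = []
nonzeroWords (suc m) = map (true ∷_) (allWords m) ++ map (false ∷_) (nonzeroWords m)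

∈-allWords⁺ : ∀ w → w ∈ allWords (length w)
∈-allWords⁺ []          = here refl
∈-allWords⁺ (true ∷ w)  = ∈-++⁺ˡ (∈-map⁺ (true ∷_) (∈-allWords⁺ w))
∈-allWords⁺ (false ∷ w) = ∈-++⁺ʳ (map (true ∷_) (allWords (length w))) (∈-map⁺ (false ∷_) (∈-allWords⁺ w))

∈-allWords⁻ : ∀ m {w} → w ∈ allWords m → length w ≡ m
∈-allWords⁻ zero    (here refl) = refl
∈-allWords⁻ (suc m) w∈ = [ go , go ]′ (∈-++⁻ (map (true ∷_) (allWords m)) w∈)
  where
  go : ∀ {b w} → w ∈ map (b ∷_) (allWords m) → length w ≡ suc m
  go {b} w∈ with v , v∈ , refl ← ∈-map⁻ (b ∷_) w∈ = cong suc (∈-allWords⁻ m v∈)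

∈-nonzeroWords⁺ : ∀ {w} → true ∈ w → w ∈ nonzeroWords (length w)
∈-nonzeroWords⁺ {true ∷ w}  _         = ∈-++⁺ˡ (∈-map⁺ (true ∷_) (∈-allWords⁺ w))
∈-nonzeroWords⁺ {false ∷ w} (there t) =
  ∈-++⁺ʳ (map (true ∷_) (allWords (length w))) (∈-map⁺ (false ∷_) (∈-nonzeroWords⁺ t))

∈-nonzeroWords⁻ : ∀ m {w} → w ∈ nonzeroWords m → length w ≡ m × true ∈ w
∈-nonzeroWords⁻ (suc m) {w} w∈ = [ go₁ , go₀ ]′ (∈-++⁻ (map (true ∷_) (allWords m)) w∈)
  where
  go₁ : w ∈ map (true ∷_) (allWords m) → length w ≡ suc m × true ∈ w
  go₁ w∈ with v , v∈ , refl ← ∈-map⁻ (true ∷_) w∈ = cong suc (∈-allWords⁻ m v∈) , here refl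

  go₀ : w ∈ map (false ∷_) (nonzeroWords m) → length w ≡ suc m × true ∈ w
  go₀ w∈ with v , v∈ , refl ← ∈-map⁻ (false ∷_) w∈ =
    let len , t = ∈-nonzeroWords⁻ m v∈ in cong suc len , there t

map-∷-disjoint : ∀ {vs ws : List Word} → Disjoint (map (true ∷_) vs) (map (false ∷_) ws)
map-∷-disjoint (p , q) with _ , _ , refl ← ∈-map⁻ (true ∷_) p with _ , _ , () ← ∈-map⁻ (false ∷_) q

unique-allWords : ∀ m → Unique (allWords m)
unique-allWords zero    = All.[] ∷ []
unique-allWords (suc m) =
  ++⁺ (Unique-map⁺ ∷-injectiveʳ (unique-allWords m))
      (Unique-map⁺ ∷-injectiveʳ (unique-allWords m)) map-∷-disjoint

unique-nonzeroWords : ∀ m → Unique (nonzeroWords m)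
unique-nonzeroWords zero    = []
unique-nonzeroWords (suc m) =
  ++⁺ (Unique-map⁺ ∷-injectiveʳ (unique-allWords m))
      (Unique-map⁺ ∷-injectiveʳ (unique-nonzeroWords m)) map-∷-disjoint

first : Word → Bool
first []      = false
first (b ∷ _) = b

-- For the words of a tour, whose first letters form the difference string, this is the sum of that
-- string mod 2.
parity : List Word → Bool
parity ws = foldr _xor_ false (map first ws)

parity-↭ : ∀ {vs ws} → vs ↭ ws → parity vs ≡ parity ws
parity-↭ p =
  foldr-commMonoid (setoid Bool) (CommutativeRing.+-isCommutativeMonoid xor-∧-commutativeRing)
    (↭⇒↭ₛ (↭-map⁺ first p))

parity-++ : ∀ vs ws → parity (vs ++ ws) ≡ parity vs xor parity ws
parity-++ []       ws = refl
parity-++ (v ∷ vs) ws =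
  trans (cong (first v xor_) (parity-++ vs ws)) (sym (xor-assoc (first v) (parity vs) (parity ws)))

parity-false∷ : ∀ ws → parity (map (false ∷_) ws) ≡ false
parity-false∷ []       = refl
parity-false∷ (w ∷ ws) = parity-false∷ ws

-- Both sides are the parity of the length of `ws`.
parity-true∷ : ∀ b ws → parity (map (true ∷_) (map (b ∷_) ws)) ≡ parity (map (true ∷_) ws)
parity-true∷ b []       = refl
parity-true∷ b (w ∷ ws) = cong not (parity-true∷ b ws)

-- Words beginning with `true` split by their second letter into two halves of equal size, which
-- cancel. The length is at least 2 so that there is a second letter.
parity-nonzeroWords : ∀ m → parity (nonzeroWords (suc (suc m))) ≡ false
parity-nonzeroWords m = begin
  parity (map (true ∷_) (allWords (suc m)) ++ map (false ∷_) (nonzeroWords (suc m)))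
    ≡⟨ parity-++ (map (true ∷_) (allWords (suc m))) _ ⟩
  parity (map (true ∷_) (allWords (suc m))) xor parity (map (false ∷_) (nonzeroWords (suc m)))
    ≡⟨ cong (parity (map (true ∷_) (allWords (suc m))) xor_) (parity-false∷ (nonzeroWords (suc m))) ⟩
  parity (map (true ∷_) (allWords (suc m))) xor false
    ≡⟨ xor-identityʳ _ ⟩
  parity (map (true ∷_) (map (true ∷_) ws ++ map (false ∷_) ws))
    ≡⟨ cong parity (map-++ (true ∷_) (map (true ∷_) ws) (map (false ∷_) ws)) ⟩
  parity (map (true ∷_) (map (true ∷_) ws) ++ map (true ∷_) (map (false ∷_) ws))
    ≡⟨ parity-++ (map (true ∷_) (map (true ∷_) ws)) _ ⟩
  parity (map (true ∷_) (map (true ∷_) ws)) xor parity (map (true ∷_) (map (false ∷_) ws))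
    ≡⟨ cong₂ _xor_ (parity-true∷ true ws) (parity-true∷ false ws) ⟩
  parity (map (true ∷_) ws) xor parity (map (true ∷_) ws)
    ≡⟨ xor-same (parity (map (true ∷_) ws)) ⟩
  false ∎
  where
  open ≡-Reasoning
  ws = allWords m

completeTour : ∀ m → ∃[ T ] ∀ {w} → length w ≡ suc m → true ∈ w → w ∈ words {suc m} T
completeTour m =
  let T , ws∈ , _ = cover (nonzeroWords (suc m)) (∈-nonzeroWords⁻ (suc m))
  in T , λ { {w} len t → ws∈ (subst (λ l → w ∈ nonzeroWords l) len (∈-nonzeroWords⁺ t)) }

-- Two repetition-free lists with the same elements are permutations of each other, and `parity`
-- ignores order.
parity-complete : ∀ {m} (T : Tour (suc (suc m))) →
                  (∀ {w} → length w ≡ suc (suc m) → true ∈ w → w ∈ words T) → parity (words T) ≡ false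
parity-complete {m} T complete = trans
  (parity-↭ (∼bag⇒↭ (unique∧set⇒bag (unique T) (unique-nonzeroWords (suc (suc m))) sameWords)))
  (parity-nonzeroWords m)
  where
  sameWords : ∀ {w} → w ∈ words T ⇔ w ∈ nonzeroWords (suc (suc m))
  sameWords {w} = mk⇔
    (λ w∈ → let len , t = valid T w∈ in subst (λ l → w ∈ nonzeroWords l) len (∈-nonzeroWords⁺ t))
    (λ w∈ → let len , t = ∈-nonzeroWords⁻ (suc (suc m)) w∈ in complete len t)

-- Periodic sequences

-- The discrete antiderivative mod 2, vanishing at 0. Taking off the front term matches the right
-- fold in `parity`.
prefixXor : (ℕ → Bool) → ℕ → Bool
prefixXor d zero    = false
prefixXor d (suc i) = d 0 xor prefixXor (d ∘ suc) i

prefixXor-suc : ∀ d i → prefixXor d (suc i) ≡ prefixXor d i xor d i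
prefixXor-suc d zero    = xor-identityʳ (d 0)
prefixXor-suc d (suc i) = trans (cong (d 0 xor_) (prefixXor-suc (d ∘ suc) i))
  (sym (xor-assoc (d 0) (prefixXor (d ∘ suc) i) (d (suc i))))

-- An antiderivative of a periodic sequence is periodic once the sum over one period vanishes.
prefixXor-+ : ∀ d N → (∀ i → d (N + i) ≡ d i) → prefixXor d N ≡ false →
              ∀ i → prefixXor d (N + i) ≡ prefixXor d i
prefixXor-+ d N per d≡0 zero    = trans (cong (prefixXor d) (+-identityʳ N)) d≡0
prefixXor-+ d N per d≡0 (suc i) = begin
  prefixXor d (N + suc i)             ≡⟨ cong (prefixXor d) (+-suc N i) ⟩
  prefixXor d (suc (N + i))           ≡⟨ prefixXor-suc d (N + i) ⟩
  prefixXor d (N + i) xor d (N + i)   ≡⟨ cong₂ _xor_ (prefixXor-+ d N per d≡0 i) (per i) ⟩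
  prefixXor d i xor d i               ≡⟨ prefixXor-suc d i ⟨
  prefixXor d (suc i)                 ∎
  where open ≡-Reasoning

periodic-% : ∀ {A : Set} (f : ℕ → A) N .{{_ : NonZero N}} → (∀ i → f (N + i) ≡ f i) →
             ∀ x → f (x % N) ≡ f x
periodic-% f N per x = trans (sym (multiple (x / N) (x % N)))
  (cong f (trans (+-comm (x / N * N) (x % N)) (sym (m≡m%n+[m/n]*n x N))))
  where
  multiple : ∀ k i → f (k * N + i) ≡ f i
  multiple zero    i = refl
  multiple (suc k) i = trans (cong f (+-assoc N (k * N) i)) (trans (per (k * N + i)) (multiple k i))

module _ {A : Set} (x : A) (xs : List A) where

  -- The argument is what remains of the current period.
  cycleAfter : List A → ℕ → A
  cycleAfter []       zero    = x
  cycleAfter []       (suc i) = cycleAfter xs i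
  cycleAfter (y ∷ ys) zero    = y
  cycleAfter (y ∷ ys) (suc i) = cycleAfter ys i

  cycle : ℕ → A
  cycle = cycleAfter (x ∷ xs)

  cycleAfter-+ : ∀ ys i → cycleAfter ys (length ys + i) ≡ cycle i
  cycleAfter-+ []       zero    = refl
  cycleAfter-+ []       (suc i) = refl
  cycleAfter-+ (y ∷ ys) i       = cycleAfter-+ ys i

  cycleAfter-lookup : ∀ ys i → cycleAfter ys (toℕ i) ≡ lookup ys i
  cycleAfter-lookup (y ∷ ys) zero    = refl
  cycleAfter-lookup (y ∷ ys) (suc i) = cycleAfter-lookup ys i

cycle-⟶ : ∀ {x xs} → Walk x (x ∷ xs) x → ∀ i → cycle x xs i ⟶ cycle x xs (suc i)
cycle-⟶ {x} {xs} (e₀ ∷ p₀) = go (e₀ ∷ p₀)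
  where
  begins : ∀ {y ys} → Walk y ys x → cycleAfter x xs ys 0 ≡ y
  begins []      = refl
  begins (_ ∷ _) = refl

  go : ∀ {y ys} → Walk y ys x → ∀ i → cycleAfter x xs ys i ⟶ cycleAfter x xs ys (suc i)
  -- The period is exhausted, so the walk is back at `x` and its next edge is again the first one,
  -- `e₀`.
  go []      zero    = subst (x ⟶_) (sym (begins p₀)) e₀
  go []      (suc i) = go p₀ i
  go (e ∷ p) zero    = subst (_ ⟶_) (sym (begins p)) e
  go (e ∷ p) (suc i) = go p i

prefixXor-cycle : ∀ {x xs} ys → prefixXor (first ∘ cycleAfter x xs ys) (length ys) ≡ parity ys
prefixXor-cycle []       = refl
prefixXor-cycle (y ∷ ys) = cong (first y xor_) (prefixXor-cycle ys)

-- Each edge drops one letter, so the letter at position j is first after j steps. The induction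
-- runs over prefixes because the appended letter `c` is not part of the original word.
take-first : ∀ k (w : ℕ → Word) → (∀ i → w i ⟶ w (suc i)) → k ≤ length (w 0) →
             take k (w 0) ≡ tabulate {n = k} (first ∘ w ∘ toℕ)
take-first zero    w e k≤ = refl
take-first (suc k) w e k≤ with w 0 | w 1 in eq | e 0
... | _ | _ | shift b u c with k≤
...   | s≤s k≤u = cong (b ∷_) (begin
  take k u                             ≡⟨ take-++ˡ k u k≤u ⟨
  take k (u ∷ʳ c)                      ≡⟨ cong (take k) eq ⟨
  take k (w 1)                         ≡⟨ take-first k (w ∘ suc) (e ∘ suc) k≤w₁ ⟩
  tabulate (first ∘ w ∘ suc ∘ toℕ)     ∎)
  where
  open ≡-Reasoning

  k≤w₁ : k ≤ length (w 1)
  k≤w₁ = subst (k ≤_) (trans (sym (length-++ u)) (cong length (sym eq))) (m≤n⇒m≤n+o 1 k≤u)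

  take-++ˡ : ∀ k (u : Word) {v} → k ≤ length u → take k (u ++ v) ≡ take k u
  take-++ˡ zero    u       _         = refl
  take-++ˡ (suc k) (b ∷ u) (s≤s k≤u) = cong (b ∷_) (take-++ˡ k u k≤u)

lookup-injective : ∀ {A : Set} {xs : List A} → Unique xs → ∀ {i j} → lookup xs i ≡ lookup xs j → i ≡ j
lookup-injective (_ ∷ _)   {zero}  {zero}  _  = refl
lookup-injective (x∉ ∷ _)  {zero}  {suc j} eq with () ← All.lookup x∉ (∈-lookup j) eq
lookup-injective (x∉ ∷ _)  {suc i} {zero}  eq with () ← All.lookup x∉ (∈-lookup i) (sym eq)
lookup-injective (_ ∷ uxs) {suc i} {suc j} eq = cong suc (lookup-injective uxs eq)

-- Strings up to exchanging the letters, and partitions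

bit : Letter → Bool
bit = Inverse.to 2↔Bool

letter : Bool → Letter
letter = Inverse.from 2↔Bool

δ : Letter → Letter → Bool
δ x y = bit x xor bit y

δ-letter : ∀ x y → δ (letter x) (letter y) ≡ x xor y
δ-letter x y = cong₂ _xor_ (Inverse.strictlyInverseˡ 2↔Bool x) (Inverse.strictlyInverseˡ 2↔Bool y)

δ≡false : ∀ x y → x ≡ y ⇔ δ x y ≡ false
δ≡false zero       zero       = mk⇔ (λ _ → refl) (λ _ → refl)
δ≡false zero       (suc zero) = mk⇔ (λ ()) (λ ())
δ≡false (suc zero) zero       = mk⇔ (λ ()) (λ ())
δ≡false (suc zero) (suc zero) = mk⇔ (λ _ → refl) (λ _ → refl)

δ≡true : ∀ x y → δ x y ≡ true → ∀ z → z ≡ x ⊎ z ≡ y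
δ≡true zero       zero       ()
δ≡true (suc zero) (suc zero) ()
δ≡true zero       (suc zero) _ zero       = inj₁ refl
δ≡true zero       (suc zero) _ (suc zero) = inj₂ refl
δ≡true (suc zero) zero       _ zero       = inj₂ refl
δ≡true (suc zero) zero       _ (suc zero) = inj₁ refl

δ-refl : ∀ x → δ x x ≡ false
δ-refl x = to (δ≡false x x) refl

-- The telescoping identity: the two occurrences of `bit y` cancel.
δ-trans : ∀ x y z → δ x y xor δ y z ≡ δ x z
δ-trans zero       zero       z = refl
δ-trans zero       (suc zero) z = not-involutive (bit z)
δ-trans (suc zero) zero       z = refl
δ-trans (suc zero) (suc zero) z = refl

δ-cancel : ∀ x y z → δ x y ≡ δ x z → y ≡ z
δ-cancel zero       y z eq = Injection.injective (↔⇒↣ 2↔Bool) eq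
δ-cancel (suc zero) y z eq = Injection.injective (↔⇒↣ 2↔Bool) (not-injective eq)

diffs : ∀ {m} → Vector Letter (suc m) → List Bool
diffs {m} r = tabulate {n = m} λ k → δ (r (inject₁ k)) (r (suc k))

infix 4 _≋_

-- Over two letters this is equality up to exchanging the letters; it is phrased by coincidences,
-- which are all that `Represents` sees.
_≋_ : ∀ {n} → Vector Letter n → Vector Letter n → Set
r ≋ s = ∀ i j → r i ≡ r j ⇔ s i ≡ s j

false-⇔⇒≡ : ∀ {b c} → b ≡ false ⇔ c ≡ false → b ≡ c
false-⇔⇒≡ {false} {c}     e = sym (to e refl)
false-⇔⇒≡ {true}  {false} e = from e refl
false-⇔⇒≡ {true}  {true}  e = refl

≋⇒diffs : ∀ {m} {r s : Vector Letter (suc m)} → r ≋ s → diffs r ≡ diffs s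
≋⇒diffs {r = r} {s} r≋s = tabulate-cong λ k → δ-cong (r≋s (inject₁ k) (suc k))
  where
  δ-cong : ∀ {x y x′ y′} → x ≡ y ⇔ x′ ≡ y′ → δ x y ≡ δ x′ y′
  δ-cong {x} {y} {x′} {y′} e = false-⇔⇒≡ (δ≡false x′ y′ ⇔-∘ (e ⇔-∘ ⇔-sym (δ≡false x y)))

-- Consecutive differences telescope to the difference from the first letter.
diffs-δ : ∀ {m} (r s : Vector Letter (suc m)) → diffs r ≡ diffs s →
          ∀ i → δ (r zero) (r i) ≡ δ (s zero) (s i)
diffs-δ r s eq zero = trans (δ-refl (r zero)) (sym (δ-refl (s zero)))
diffs-δ {suc m} r s eq (suc i) = begin
  δ (r zero) (r (suc i))
    ≡⟨ δ-trans (r zero) (r (suc zero)) (r (suc i)) ⟨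
  δ (r zero) (r (suc zero)) xor δ (r (suc zero)) (r (suc i))
    ≡⟨ cong₂ _xor_ (∷-injectiveˡ eq) (diffs-δ (r ∘ suc) (s ∘ suc) (∷-injectiveʳ eq) i) ⟩
  δ (s zero) (s (suc zero)) xor δ (s (suc zero)) (s (suc i))
    ≡⟨ δ-trans (s zero) (s (suc zero)) (s (suc i)) ⟩
  δ (s zero) (s (suc i)) ∎
  where open ≡-Reasoning

diffs⇒≋ : ∀ {m} (r s : Vector Letter (suc m)) → diffs r ≡ diffs s → r ≋ s
diffs⇒≋ r s eq i j = mk⇔ (half r s eq) (half s r (sym eq))
  where
  half : ∀ r s → diffs r ≡ diffs s → r i ≡ r j → s i ≡ s j
  half r s eq ri≡rj = δ-cancel (s zero) (s i) (s j)
    (trans (sym (diffs-δ r s eq i)) (trans (cong (δ (r zero)) ri≡rj) (diffs-δ r s eq j)))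

true∈diffs⁺ : ∀ {m} (r : Vector Letter (suc m)) i → r i ≢ r zero → true ∈ diffs r
true∈diffs⁺ {m} r zero ri≢r0 = contradiction refl ri≢r0
true∈diffs⁺ {suc m} r (suc i) ri≢r0 with δ (r zero) (r (suc zero)) in eq
... | true  = here refl
... | false = there (true∈diffs⁺ (r ∘ suc) i λ e →
  ri≢r0 (trans e (sym (from (δ≡false (r zero) (r (suc zero))) eq))))

-- Two adjacent letters that differ exhaust the alphabet.
true∈diffs⁻ : ∀ {m} (r : Vector Letter (suc m)) → true ∈ diffs r → ∀ b → ∃[ i ] r i ≡ b
true∈diffs⁻ {suc m} r (here eq) b with δ≡true (r zero) (r (suc zero)) (sym eq) b
... | inj₁ e = zero , sym e
... | inj₂ e = suc zero , sym e
true∈diffs⁻ {suc m} r (there t) b = let i , e = true∈diffs⁻ (r ∘ suc) t b in suc i , e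

module _ {n k : ℕ} (p : Partition n k) where

  partOf : Fin n → Fin k
  partOf x = proj₁ (covers p x)

  ∈⇒partOf : ∀ {x b} → x ∈ₛ part p b → partOf x ≡ b
  ∈⇒partOf x∈ = disjoint p (proj₂ (covers p _)) x∈

  samePart⇔partOf : ∀ x y → SamePart p x y ⇔ partOf x ≡ partOf y
  samePart⇔partOf x y = mk⇔
    (λ { (_ , (b , refl) , x∈ , y∈) → trans (∈⇒partOf x∈) (sym (∈⇒partOf y∈)) })
    (λ eq → part p (partOf x) , (partOf x , refl) , proj₂ (covers p x) ,
            subst (λ b → y ∈ₛ part p b) (sym eq) (proj₂ (covers p y)))

part-⊆ : ∀ {n k} (p q : Partition n k) {x b c} → (∀ y → SamePart p x y → SamePart q x y) →
         x ∈ₛ part p b → x ∈ₛ part q c → part p b ⊆ part q c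
part-⊆ p q same x∈p x∈q {y} y∈p
  with _ , (d , refl) , x∈d , y∈d ← same y (_ , (_ , refl) , x∈p , y∈p) =
  subst (λ d → y ∈ₛ part q d) (disjoint q x∈d x∈q) y∈d

samePart-isPartOf : ∀ {n k} (p q : Partition n k) → (∀ x y → SamePart p x y ⇔ SamePart q x y) →
                    ∀ s → IsPartOf s p → IsPartOf s q
samePart-isPartOf p q same _ (b , refl) =
  let x , x∈p = nonempty p b
      c , x∈q = covers q x
  in c , ⊆-antisym (part-⊆ q p (λ y → from (same x y)) x∈q x∈p)
                   (part-⊆ p q (λ y → to (same x y)) x∈p x∈q)

-- A partition is determined by its equivalence relation: each part is the class of any of its
-- elements.
samePart⇒≈ₚ : ∀ {n k} (p q : Partition n k) → (∀ x y → SamePart p x y ⇔ SamePart q x y) → p ≈ₚ q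
samePart⇒≈ₚ p q same s =
  mk⇔ (samePart-isPartOf p q same s) (samePart-isPartOf q p (λ x y → ⇔-sym (same x y)) s)

≈ₚ⇒samePart : ∀ {n k} (p q : Partition n k) → p ≈ₚ q → ∀ x y → SamePart p x y → SamePart q x y
≈ₚ⇒samePart p q p≈q x y (s , s∈p , x∈ , y∈) = s , to (p≈q s) s∈p , x∈ , y∈

represents-≋ : ∀ {n} {r s : Vector Letter n} {p} → Represents r p → Represents s p → r ≋ s
represents-≋ r s i j = ⇔-sym (s i j) ⇔-∘ r i j

represents-resp-≋ : ∀ {n} {r s : Vector Letter n} {p} → r ≋ s → Represents s p → Represents r p
represents-resp-≋ r≋s s i j = s i j ⇔-∘ r≋s i j

represents-resp-≈ₚ : ∀ {n} {r : Vector Letter n} p q → p ≈ₚ q → Represents r p → Represents r q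
represents-resp-≈ₚ p q p≈q r i j =
  mk⇔ (≈ₚ⇒samePart p q p≈q i j) (≈ₚ⇒samePart q p (⇔-sym ∘ p≈q) i j) ⇔-∘ r i j

represents-≈ₚ : ∀ {n} {r : Vector Letter n} p q → Represents r p → Represents r q → p ≈ₚ q
represents-≈ₚ p q rp rq = samePart⇒≈ₚ p q λ x y → rq x y ⇔-∘ ⇔-sym (rp x y)

-- The indices of the two parts serve as letters, so every partition has a representing string.
partOf-represents : ∀ {n} (p : Partition n 2) → Represents (partOf p) p
partOf-represents p i j = ⇔-sym (samePart⇔partOf p i j)

-- The part that misses position `zero` is nonempty, so the string is not constant.
partOf-diffs : ∀ {m} (p : Partition (suc m) 2) → true ∈ diffs (partOf p)
partOf-diffs p with partOf p zero in eq
... | zero     = let x , x∈ = nonempty p (suc zero) in true∈diffs⁺ (partOf p) x λ e →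
  contradiction (trans (sym (trans e eq)) (∈⇒partOf p x∈)) λ ()
... | suc zero = let x , x∈ = nonempty p zero in true∈diffs⁺ (partOf p) x λ e →
  contradiction (trans (sym (trans e eq)) (∈⇒partOf p x∈)) λ ()

module _ {m} (r : Vector Letter (suc m)) (t : true ∈ diffs r) where

  private
    fibre : Letter → Subset (suc m)
    fibre b = Vec.tabulate λ x → does (r x ≟ᶠ b)

    ∈-fibre⁺ : ∀ {x b} → r x ≡ b → x ∈ₛ fibre b
    ∈-fibre⁺ {x} {b} e = lookup⇒[]= x (fibre b)
      (trans (lookup∘tabulate (λ y → does (r y ≟ᶠ b)) x) (dec-true (r x ≟ᶠ b) e))

    ∈-fibre⁻ : ∀ {x b} → x ∈ₛ fibre b → r x ≡ b
    ∈-fibre⁻ {x} {b} x∈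
      with r x ≟ᶠ b | trans (sym (lookup∘tabulate (λ x → does (r x ≟ᶠ b)) x)) ([]=⇒lookup x∈)
    ... | yes e | _ = e

  fibres : Partition (suc m) 2
  fibres = record
    { part     = fibre
    ; nonempty = λ b → let x , e = true∈diffs⁻ r t b in x , ∈-fibre⁺ e
    ; disjoint = λ p q → trans (sym (∈-fibre⁻ p)) (∈-fibre⁻ q)
    ; covers   = λ x → r x , ∈-fibre⁺ refl
    }

  fibres-represents : Represents r fibres
  -- `covers` picks the index `r x`, so `partOf fibres` reduces to `r`.
  fibres-represents = partOf-represents fibres

-- Difference words classify strings up to exchanging the letters, so positions of windows
-- correspond bijectively to partitions. This one bijection gives both the length and the unique
-- window.
isUcycle : ∀ {m N} (a : Vector Letter N) →
           (∀ i → true ∈ diffs (window (suc m) a i)) →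
           (∀ r → true ∈ diffs r → ∃! _≡_ λ i → diffs (window (suc m) a i) ≡ diffs r) →
           IsUcycle (suc m) a
isUcycle {m} {N} a nonconstant exactlyOne = record
  { length = record
    { to        = partition
    ; from      = position
    ; to-cong   = λ { refl s → ⇔-id _ }
    ; from-cong = λ {p} {q} p≈q →
        position-unique p (represents-resp-≈ₚ q p (⇔-sym ∘ p≈q) (position-represents q))
    ; inverse   =
        (λ { {p} refl →
          represents-≈ₚ (partition (position p)) p (partition-represents (position p)) (position-represents p) })
      , (λ {i} {p} p≈ →
          position-unique p (represents-resp-≈ₚ (partition i) p (⇔-sym ∘ p≈) (partition-represents i)))
    }
  ; represents = λ p → position p , position-represents p , position-unique p
  }
  where
  partition : Fin N → Partition (suc m) 2
  partition i = fibres (window (suc m) a i) (nonconstant i)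

  partition-represents : ∀ i → Represents (window (suc m) a i) (partition i)
  partition-represents i = fibres-represents (window (suc m) a i) (nonconstant i)

  position : Partition (suc m) 2 → Fin N
  position p = proj₁ (exactlyOne (partOf p) (partOf-diffs p))

  position-represents : ∀ p → Represents (window (suc m) a (position p)) p
  position-represents p = represents-resp-≋ {p = p}
    (diffs⇒≋ (window (suc m) a (position p)) (partOf p)
             (proj₁ (proj₂ (exactlyOne (partOf p) (partOf-diffs p)))))
    (partOf-represents p)

  position-unique : ∀ p {i} → Represents (window (suc m) a i) p → position p ≡ i
  position-unique p r = proj₂ (proj₂ (exactlyOne (partOf p) (partOf-diffs p)))
    (≋⇒diffs (represents-≋ {p = p} r (partOf-represents p)))

-- Integration of a tour to a cyclic string

module _ {m} (T : Tour m) (even : parity (words T) ≡ false) where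

  private
    N : ℕ
    N = length (words T)

    w : ℕ → Word
    w = cycle (start T) (rest T)

    A : ℕ → Bool
    A = prefixXor (first ∘ w)

    -- Evenness closes the integral around the cycle, so that windows may wrap around modulo `N`.
    A-+N : ∀ i → A (N + i) ≡ A i
    A-+N = prefixXor-+ (first ∘ w) N (cong first ∘ cycleAfter-+ (start T) (rest T) (words T))
                       (trans (prefixXor-cycle (words T)) even)

    A-mod : ∀ x → A (toℕ (x mod N)) ≡ A x
    A-mod x = trans (cong A (toℕ-fromℕ< (m%n<n x N))) (periodic-% A N A-+N x)

  antiderivative : Vector Letter N
  antiderivative = letter ∘ A ∘ toℕ

  -- Differencing undoes the integration and leaves the first letters of `m` successive words of the
  -- walk; these spell the word at position `i`.
  diffs-window : ∀ i → diffs (window (suc m) antiderivative i) ≡ lookup (words T) i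
  diffs-window i = begin
    diffs (window (suc m) antiderivative i)
      ≡⟨ tabulate-cong difference ⟩
    tabulate {n = m} (λ k → first (w (toℕ i + toℕ k)))
      ≡⟨ take-first m (λ j → w (toℕ i + j)) edge (≤-reflexive (sym len)) ⟨
    take m (w (toℕ i + 0))
      ≡⟨ take-all m (w (toℕ i + 0)) (≤-reflexive len) ⟩
    w (toℕ i + 0)
      ≡⟨ w-lookup ⟩
    lookup (words T) i ∎
    where
    open ≡-Reasoning

    w-lookup : w (toℕ i + 0) ≡ lookup (words T) i
    w-lookup = trans (cong w (+-identityʳ (toℕ i))) (cycleAfter-lookup (start T) (rest T) (words T) i)

    len : length (w (toℕ i + 0)) ≡ m
    len = trans (cong length w-lookup) (proj₁ (valid T (∈-lookup i)))

    edge : ∀ j → w (toℕ i + j) ⟶ w (toℕ i + suc j)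
    edge j = subst (λ k → w (toℕ i + j) ⟶ w k) (sym (+-suc (toℕ i) j)) (cycle-⟶ (walk T) (toℕ i + j))

    difference : ∀ k → δ (window (suc m) antiderivative i (inject₁ k))
                         (window (suc m) antiderivative i (suc k)) ≡ first (w (toℕ i + toℕ k))
    difference k = begin
      δ (letter (A (toℕ (y mod N)))) (letter (A (toℕ (z mod N))))
        ≡⟨ δ-letter (A (toℕ (y mod N))) (A (toℕ (z mod N))) ⟩
      A (toℕ (y mod N)) xor A (toℕ (z mod N))
        ≡⟨ cong₂ _xor_ (A-mod y) (A-mod z) ⟩
      A y xor A z
        ≡⟨ cong₂ (λ j l → A j xor A l) (cong (toℕ i +_) (toℕ-inject₁ k)) (+-suc (toℕ i) (toℕ k)) ⟩
      A x xor A (suc x)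
        ≡⟨ cong (A x xor_) (prefixXor-suc (first ∘ w) x) ⟩
      A x xor (A x xor first (w x))
        ≡⟨ xor-assoc (A x) (A x) (first (w x)) ⟨
      (A x xor A x) xor first (w x)
        ≡⟨ cong (_xor first (w x)) (xor-same (A x)) ⟩
      first (w x) ∎
      where
      x y z : ℕ
      x = toℕ i + toℕ k
      y = toℕ i + toℕ (inject₁ k)
      z = toℕ i + suc (toℕ k)

corollary13 : ∀ (n : ℕ) → 3 ≤ n → ∃[ N ] Σ[ a ∈ Vector Letter N ] IsUcycle n a
corollary13 _ (s≤s (s≤s (s≤s (z≤n {m})))) = length (words T) , a , isUcycle a
  (λ i → subst (true ∈_) (sym (diffs-a i)) (proj₂ (valid T (∈-lookup i))))
  (λ r t →
    -- The difference word of `r` is nonzero of length n - 1, hence a vertex of `T`; its position in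
    -- the tour is that of the window.
    let r∈ = complete (length-tabulate λ k → δ (r (inject₁ k)) (r (suc k))) t
    in index r∈ , trans (diffs-a (index r∈)) (sym (lookup-index r∈)) ,
       λ {i} eq → lookup-injective (unique T) (trans (sym (lookup-index r∈)) (trans (sym eq) (diffs-a i))))
  where
  T : Tour (suc (suc m))
  T = proj₁ (completeTour (suc m))

  complete : ∀ {w} → length w ≡ suc (suc m) → true ∈ w → w ∈ words T
  complete = proj₂ (completeTour (suc m))

  even : parity (words T) ≡ false
  even = parity-complete T complete

  a : Vector Letter (length (words T))
  a = antiderivative T even

  diffs-a : ∀ i → diffs (window (suc (suc (suc m))) a i) ≡ lookup (words T) i
  diffs-a = diffs-window T even
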